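{- For all SCL-terms $t$ and $t'$ (possibly containing variables), $$\mathrm{MSCL}\vdash t=t'\quad\Longrightarrow\quad \mathrm{EqMSCL}\vdash t=t' .$$
   Context: Fix a countable set $A$ of atoms, treated as constants. $\curlywedge$ and $\curlyvee$ denote the binary connectives left-sequential (short-circuit) conjunction and disjunction. SCL-terms are terms built from variables, the constants $\mathsf T,\mathsf F$, atoms $a\in A$, the unary $\neg$ and the binary $\curlywedge,\curlyvee$. $\vdash$ is derivability in equational logic. $\mathrm{CP}_{mem}$ is the following set of axioms over the signature with constants $\mathsf T,\mathsf F$, atoms, and the ternary conditional $x\triangleleft y\triangleright z$ (read: if $y$ then $x$ else $z$): (CP1) $x\triangleleft\mathsf T\triangleright y=x$; (CP2) $x\triangleleft\mathsf F\triangleright y=y$; (CP3) $\mathsf T\triangleleft x\triangleright\mathsf F=x$; (CP4) $x\triangleleft(y\triangleleft z\triangleright u)\triangleright v=(x\triangleleft y\triangleright v)\triangleleft z\triangleright(x\triangleleft u\triangleright v)$; (CPmem) $x\triangleleft y\triangleright(z\triangleleft u\triangleright(v\triangleleft y\triangleright w))=x\triangleleft y\triangleright(z\triangleleft u\triangleright w)$. MSCL (memorizing short-circuit logic): for SCL-terms $t,t'$, $\mathrm{MSCL}\vdash t=t'$ means that $t=t'$ is derivable in equational logic from $\mathrm{CP}_{mem}$ together with the defining equations $\neg x=\mathsf F\triangleleft x\triangleright\mathsf T$, $x\curlywedge y=y\triangleleft x\triangleright\mathsf F$, and $x\curlyvee y=\neg(\neg x\curlywedge\neg y)$. EqMSCL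 is the following set of equations over SCL-terms: (SCL1) $\mathsf F=\neg\mathsf T$; (SCL2) $x\curlyvee y=\neg(\neg x\curlywedge\neg y)$; (SCL3) $\neg\neg x=x$; (SCL4) $\mathsf T\curlywedge x=x$; (SCL5) $x\curlywedge\mathsf T=x$; (SCL6) $\mathsf F\curlywedge x=\mathsf F$; (SCL7) $(x\curlywedge y)\curlywedge z=x\curlywedge(y\curlywedge z)$; (SCL8) $x\curlywedge\mathsf F=\neg x\curlywedge\mathsf F$; (MSCL1) $x\curlywedge(x\curlyvee y)=x$; (MSCL2) $x\curlywedge(y\curlyvee z)=(x\curlywedge y)\curlyvee(x\curlywedge z)$; (MSCL3) $(x\curlyvee y)\curlywedge(\neg x\curlyvee z)=(\neg x\curlyvee z)\curlywedge(x\curlyvee y)$; (MSCL4) $((x\curlywedge y)\curlyvee(\neg x\curlywedge z))\curlywedge u=(x\curlyvee(z\curlywedge u))\curlywedge(\neg x\curlyvee(y\curlywedge u))$. -}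

module Defs where

open import Data.Nat.Base using (ℕ)
open import Data.Vec.Base using (Vec; []; _∷_)
open import Data.Vec.Relation.Binary.Pointwise.Inductive using (Pointwise)
open import Level using (0ℓ)
open import Relation.Binary.Core using (Rel)
open import Relation.Binary.Construct.Union using (_∪_)

-- Sig n is the set of n-ary operation symbols.
Signature : Set₁
Signature = ℕ → Set

data Term (Sig : Signature) : Set where
  var : ℕ → Term Sig
  op  : ∀ {n} → Sig n → Vec (Term Sig) n → Term Sig

module _ {Sig : Signature} where

  infixl 30 _[_] _[_]*

  _[_]  : Term Sig → (ℕ → Term Sig) → Term Sig
  _[_]* : ∀ {n} → Vec (Term Sig) n → (ℕ → Term Sig) → Vec (Term Sig) n

  var i   [ σ ] = σ i
  op f ts [ σ ] = op f (ts [ σ ]*)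

  []       [ σ ]* = []
  (t ∷ ts) [ σ ]* = t [ σ ] ∷ ts [ σ ]*

Theory : Signature → Set₁
Theory Sig = Rel (Term Sig) 0ℓ

infix 4 _⊢_≈_

data _⊢_≈_ {Sig : Signature} (E : Theory Sig) : Rel (Term Sig) 0ℓ where
  axiom : ∀ {s t} → E s t → E ⊢ s ≈ t
  refl  : ∀ {t} → E ⊢ t ≈ t
  sym   : ∀ {s t} → E ⊢ s ≈ t → E ⊢ t ≈ s
  trans : ∀ {r s t} → E ⊢ r ≈ s → E ⊢ s ≈ t → E ⊢ r ≈ t
  cong  : ∀ {n} (f : Sig n) {ss ts : Vec (Term Sig) n} →
          Pointwise (E ⊢_≈_) ss ts → E ⊢ op f ss ≈ op f ts
  subst : ∀ {s t} (σ : ℕ → Term Sig) → E ⊢ s ≈ t → E ⊢ s [ σ ] ≈ t [ σ ]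

data SCLOp (A : Set) : Signature where
  true false : SCLOp A 0
  atom       : A → SCLOp A 0
  neg        : SCLOp A 1
  conj disj  : SCLOp A 2

-- All equations of MSCL are over this joint signature, so derivations may
-- pass through terms that are not SCL-terms.
data MSCLOp (A : Set) : Signature where
  true false : MSCLOp A 0
  atom       : A → MSCLOp A 0
  neg        : MSCLOp A 1
  conj disj  : MSCLOp A 2
  cond       : MSCLOp A 3

SCLTerm : Set → Set
SCLTerm A = Term (SCLOp A)

MSCLTerm : Set → Set
MSCLTerm A = Term (MSCLOp A)

-- These use overloaded constructors, so they serve both signatures.
infix  9 ¬_
infix  8 _⋏_ _⋎_
infix  7 _◁_▷_

pattern T         = op true []
pattern F         = op false []
pattern ¬_ s      = op neg (s ∷ [])
pattern _⋏_ s t   = op conj (s ∷ t ∷ [])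
pattern _⋎_ s t   = op disj (s ∷ t ∷ [])
pattern _◁_▷_ r s t = op cond (r ∷ s ∷ t ∷ [])

module _ {A : Set} where

  embedOp : ∀ {n} → SCLOp A n → MSCLOp A n
  embedOp true     = true
  embedOp false    = false
  embedOp (atom a) = atom a
  embedOp neg      = neg
  embedOp conj     = conj
  embedOp disj     = disj

  embed  : SCLTerm A → MSCLTerm A
  embed* : ∀ {n} → Vec (SCLTerm A) n → Vec (MSCLTerm A) n

  embed (var i)   = var i
  embed (op f ts) = op (embedOp f) (embed* ts)

  embed* []       = []
  embed* (t ∷ ts) = embed t ∷ embed* ts

-- The axioms are concrete equations in these variables; their instances
-- come from the rule subst.
x y z u v w : ∀ {Sig} → Term Sig
x = var 0
y = var 1
z = var 2
u = var 3
v = var 4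
w = var 5

data CPmem (A : Set) : Theory (MSCLOp A) where
  CP1      : CPmem A (x ◁ T ▷ y) x
  CP2      : CPmem A (x ◁ F ▷ y) y
  CP3      : CPmem A (T ◁ x ▷ F) x
  CP4      : CPmem A (x ◁ (y ◁ z ▷ u) ▷ v)
                     ((x ◁ y ▷ v) ◁ z ▷ (x ◁ u ▷ v))
  CPmem-ax : CPmem A (x ◁ y ▷ (z ◁ u ▷ (v ◁ y ▷ w)))
                     (x ◁ y ▷ (z ◁ u ▷ w))

data Defining (A : Set) : Theory (MSCLOp A) where
  ¬-def : Defining A (¬ x) (F ◁ x ▷ T)
  ⋏-def : Defining A (x ⋏ y) (y ◁ x ▷ F)
  ⋎-def : Defining A (x ⋎ y) (¬ (¬ x ⋏ ¬ y))

MSCL : (A : Set) → Theory (MSCLOp A)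
MSCL A = CPmem A ∪ Defining A

data EqMSCL (A : Set) : Theory (SCLOp A) where
  SCL1  : EqMSCL A F (¬ T)
  SCL2  : EqMSCL A (x ⋎ y) (¬ (¬ x ⋏ ¬ y))
  SCL3  : EqMSCL A (¬ (¬ x)) x
  SCL4  : EqMSCL A (T ⋏ x) x
  SCL5  : EqMSCL A (x ⋏ T) x
  SCL6  : EqMSCL A (F ⋏ x) F
  SCL7  : EqMSCL A ((x ⋏ y) ⋏ z) (x ⋏ (y ⋏ z))
  SCL8  : EqMSCL A (x ⋏ F) (¬ x ⋏ F)
  MSCL1 : EqMSCL A (x ⋏ (x ⋎ y)) x
  MSCL2 : EqMSCL A (x ⋏ (y ⋎ z)) ((x ⋏ y) ⋎ (x ⋏ z))
  MSCL3 : EqMSCL A ((x ⋎ y) ⋏ (¬ x ⋎ z)) ((¬ x ⋎ z) ⋏ (x ⋎ y))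
  MSCL4 : EqMSCL A (((x ⋏ y) ⋎ (¬ x ⋏ z)) ⋏ u)
                   ((x ⋎ (z ⋏ u)) ⋏ (¬ x ⋎ (y ⋏ u)))

{-# OPTIONS --safe #-}
module Submission where

open import Defs
open import Data.Nat.Base using (ℕ)
open import Data.Sum.Base using (inj₁; inj₂)
open import Data.Vec.Base using (Vec; []; _∷_)
open import Data.Vec.Relation.Binary.Pointwise.Inductive using (Pointwise; []; _∷_)
open import Function.Bundles using (_↣_)
open import Relation.Binary.Bundles using (Setoid)
open import Relation.Binary.PropositionalEquality as ≡ using (_≡_)
import Relation.Binary.Reasoning.Setoid as SetoidReasoning

-- The conditional is definable in SCL: r ◁ s ▷ t becomes (s ⋏ r) ⋎ (¬ s ⋏ t).
-- This interpretation fixes SCL-terms and commutes with substitution, so it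
-- suffices that EqMSCL proves the interpreted axioms of MSCL.  The key facts are
-- that negation, _ ⋏ s (by MSCL4) and hence _ ⋎ s move into the branches of the
-- defined conditional, that p ⋏ ¬ p ≈ p ⋏ F, and that p ⋏ q ≈ (¬ p ⋎ q) ⋏ p, so
-- that p is still remembered after q: p ⋏ r ≈ p ⋏ s implies
-- (p ⋏ q) ⋏ r ≈ (p ⋏ q) ⋏ s.

module _ {A : Set} where

  -- Derivability in EqMSCL and the instances of its axioms

  infix 4 _≈_

  _≈_ : SCLTerm A → SCLTerm A → Set
  s ≈ t = EqMSCL A ⊢ s ≈ t

  ≈-setoid : Setoid _ _
  ≈-setoid = record
    { Carrier       = SCLTerm A
    ; _≈_           = _≈_
    ; isEquivalence = record { refl = refl ; sym = sym ; trans = trans }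
    }

  open SetoidReasoning ≈-setoid

  private variable
    p p′ q q′ r r′ s : SCLTerm A

  ¬-cong : p ≈ p′ → ¬ p ≈ ¬ p′
  ¬-cong e = cong neg (e ∷ [])

  ⋏-cong : p ≈ p′ → q ≈ q′ → p ⋏ q ≈ p′ ⋏ q′
  ⋏-cong e f = cong conj (e ∷ f ∷ [])

  ⋏-congˡ : q ≈ q′ → p ⋏ q ≈ p ⋏ q′
  ⋏-congˡ = ⋏-cong refl

  ⋏-congʳ : p ≈ p′ → p ⋏ q ≈ p′ ⋏ q
  ⋏-congʳ e = ⋏-cong e refl

  ⋎-cong : p ≈ p′ → q ≈ q′ → p ⋎ q ≈ p′ ⋎ q′
  ⋎-cong e f = cong disj (e ∷ f ∷ [])

  -- The axioms of EqMSCL mention only the first four variables, so the last clause can give `s` to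
  -- every later index too.
  assign : (p q r s : SCLTerm A) → ℕ → SCLTerm A
  assign p q r s 0 = p
  assign p q r s 1 = q
  assign p q r s 2 = r
  assign p q r s _ = s

  instantiate : ∀ {l m} → EqMSCL A l m → ∀ p q r s →
                l [ assign p q r s ] ≈ m [ assign p q r s ]
  instantiate e p q r s = subst (assign p q r s) (axiom e)

  F≈¬T : F ≈ ¬ T
  F≈¬T = axiom SCL1

  ⋎-deMorgan : ∀ p q → p ⋎ q ≈ ¬ (¬ p ⋏ ¬ q)
  ⋎-deMorgan p q = instantiate SCL2 p q T T

  ¬-involutive : ∀ p → ¬ (¬ p) ≈ p
  ¬-involutive p = instantiate SCL3 p T T T

  ⋏-identityˡ : ∀ p → T ⋏ p ≈ p
  ⋏-identityˡ p = instantiate SCL4 p T T T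

  ⋏-identityʳ : ∀ p → p ⋏ T ≈ p
  ⋏-identityʳ p = instantiate SCL5 p T T T

  ⋏-zeroˡ : ∀ p → F ⋏ p ≈ F
  ⋏-zeroˡ p = instantiate SCL6 p T T T

  ⋏-assoc : ∀ p q r → (p ⋏ q) ⋏ r ≈ p ⋏ (q ⋏ r)
  ⋏-assoc p q r = instantiate SCL7 p q r T

  ⋏-F : ∀ p → p ⋏ F ≈ ¬ p ⋏ F
  ⋏-F p = instantiate SCL8 p T T T

  ⋏-absorbs-⋎ : ∀ p q → p ⋏ (p ⋎ q) ≈ p
  ⋏-absorbs-⋎ p q = instantiate MSCL1 p q T T

  ⋏-distribˡ-⋎ : ∀ p q r → p ⋏ (q ⋎ r) ≈ (p ⋏ q) ⋎ (p ⋏ r)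
  ⋏-distribˡ-⋎ p q r = instantiate MSCL2 p q r T

  ⋎-⋏-¬⋎-comm : ∀ p q r → (p ⋎ q) ⋏ (¬ p ⋎ r) ≈ (¬ p ⋎ r) ⋏ (p ⋎ q)
  ⋎-⋏-¬⋎-comm p q r = instantiate MSCL3 p q r T

  -- De Morgan laws, units and idempotence

  ¬F≈T : ¬ F ≈ T
  ¬F≈T = trans (¬-cong F≈¬T) (¬-involutive T)

  ¬-⋏ : ∀ p q → ¬ (p ⋏ q) ≈ ¬ p ⋎ ¬ q
  ¬-⋏ p q = sym (trans (⋎-deMorgan (¬ p) (¬ q))
                       (¬-cong (⋏-cong (¬-involutive p) (¬-involutive q))))

  ¬-⋎ : ∀ p q → ¬ (p ⋎ q) ≈ ¬ p ⋏ ¬ q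
  ¬-⋎ p q = trans (¬-cong (⋎-deMorgan p q)) (¬-involutive (¬ p ⋏ ¬ q))

  ⋎-identityˡ : ∀ p → F ⋎ p ≈ p
  ⋎-identityˡ p = begin
    F ⋎ p          ≈⟨ ⋎-deMorgan F p ⟩
    ¬ (¬ F ⋏ ¬ p)  ≈⟨ ¬-cong (⋏-congʳ ¬F≈T) ⟩
    ¬ (T ⋏ ¬ p)    ≈⟨ ¬-cong (⋏-identityˡ (¬ p)) ⟩
    ¬ (¬ p)        ≈⟨ ¬-involutive p ⟩
    p              ∎

  ⋎-identityʳ : ∀ p → p ⋎ F ≈ p
  ⋎-identityʳ p = begin
    p ⋎ F          ≈⟨ ⋎-deMorgan p F ⟩
    ¬ (¬ p ⋏ ¬ F)  ≈⟨ ¬-cong (⋏-congˡ ¬F≈T) ⟩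
    ¬ (¬ p ⋏ T)    ≈⟨ ¬-cong (⋏-identityʳ (¬ p)) ⟩
    ¬ (¬ p)        ≈⟨ ¬-involutive p ⟩
    p              ∎

  ⋏-idem : ∀ p → p ⋏ p ≈ p
  ⋏-idem p = trans (⋏-congˡ (sym (⋎-identityʳ p))) (⋏-absorbs-⋎ p F)

  -- Stands in for the classical law `p ⋏ F ≈ F`: the disjunct `p ⋏ F` arises from distributing `p`
  -- over `q ⋎ F`, hence it vanishes.
  ⋏-⋎-⋏F : ∀ p q → (p ⋏ q) ⋎ (p ⋏ F) ≈ p ⋏ q
  ⋏-⋎-⋏F p q = trans (sym (⋏-distribˡ-⋎ p q F)) (⋏-congˡ (⋎-identityʳ q))

  ⋏F-⋎-⋏ : ∀ p q → (p ⋏ F) ⋎ (p ⋏ q) ≈ p ⋏ q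
  ⋏F-⋎-⋏ p q = trans (sym (⋏-distribˡ-⋎ p F q)) (⋏-congˡ (⋎-identityˡ q))

  -- The defined conditional and the memory of earlier conditions

  ite : (r s t : SCLTerm A) → SCLTerm A
  ite r s t = (s ⋏ r) ⋎ (¬ s ⋏ t)

  ite-cong : p ≈ p′ → q ≈ q′ → r ≈ r′ → ite p q r ≈ ite p′ q′ r′
  ite-cong e f g = ⋎-cong (⋏-cong f e) (⋏-cong (¬-cong f) g)

  -- `MSCL4` with `T` for its last variable. In this conjunctive form, `MSCL3` can exchange the two
  -- conjuncts.
  ite-⋎-form : ∀ p q r → ite p q r ≈ (q ⋎ r) ⋏ (¬ q ⋎ p)
  ite-⋎-form p q r = begin
    ite p q r                      ≈⟨ ⋏-identityʳ (ite p q r) ⟨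
    ite p q r ⋏ T                  ≈⟨ instantiate MSCL4 q p r T ⟩
    (q ⋎ (r ⋏ T)) ⋏ (¬ q ⋎ (p ⋏ T))
      ≈⟨ ⋏-cong (⋎-cong refl (⋏-identityʳ r)) (⋎-cong refl (⋏-identityʳ p)) ⟩
    (q ⋎ r) ⋏ (¬ q ⋎ p)            ∎

  -- The right-hand side of `MSCL4` is already the conjunctive form of the new conditional.
  ite-⋏ : ∀ p q r s → ite p q r ⋏ s ≈ ite (p ⋏ s) q (r ⋏ s)
  ite-⋏ p q r s = trans (instantiate MSCL4 q p r s)
                        (sym (ite-⋎-form (p ⋏ s) q (r ⋏ s)))

  -- De Morgan yields the conjunctive form with its conjuncts in the wrong order; `MSCL3` repairs
  -- this.
  ¬-ite : ∀ p q r → ¬ (ite p q r) ≈ ite (¬ p) q (¬ r)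
  ¬-ite p q r = begin
    ¬ (ite p q r)                      ≈⟨ ¬-⋎ (q ⋏ p) (¬ q ⋏ r) ⟩
    ¬ (q ⋏ p) ⋏ ¬ (¬ q ⋏ r)            ≈⟨ ⋏-cong (¬-⋏ q p) (¬-⋏ (¬ q) r) ⟩
    (¬ q ⋎ ¬ p) ⋏ (¬ (¬ q) ⋎ ¬ r)      ≈⟨ ⋏-congˡ (⋎-cong (¬-involutive q) refl) ⟩
    (¬ q ⋎ ¬ p) ⋏ (q ⋎ ¬ r)            ≈⟨ ⋎-⋏-¬⋎-comm q (¬ r) (¬ p) ⟨
    (q ⋎ ¬ r) ⋏ (¬ q ⋎ ¬ p)            ≈⟨ ite-⋎-form (¬ p) q (¬ r) ⟨
    ite (¬ p) q (¬ r)                  ∎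

  ite-⋎ : ∀ p q r s → ite p q r ⋎ s ≈ ite (p ⋎ s) q (r ⋎ s)
  ite-⋎ p q r s = begin
    ite p q r ⋎ s                              ≈⟨ ⋎-deMorgan (ite p q r) s ⟩
    ¬ (¬ (ite p q r) ⋏ ¬ s)                    ≈⟨ ¬-cong (⋏-congʳ (¬-ite p q r)) ⟩
    ¬ (ite (¬ p) q (¬ r) ⋏ ¬ s)                ≈⟨ ¬-cong (ite-⋏ (¬ p) q (¬ r) (¬ s)) ⟩
    ¬ (ite (¬ p ⋏ ¬ s) q (¬ r ⋏ ¬ s))          ≈⟨ ¬-ite (¬ p ⋏ ¬ s) q (¬ r ⋏ ¬ s) ⟩
    ite (¬ (¬ p ⋏ ¬ s)) q (¬ (¬ r ⋏ ¬ s))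
      ≈⟨ ite-cong (sym (⋎-deMorgan p s)) refl (sym (⋎-deMorgan r s)) ⟩
    ite (p ⋎ s) q (r ⋎ s)                      ∎

  -- Up to units, `p ⋏ ¬ p` is the conjunctive form of a conditional with both branches `F`, whose
  -- two disjuncts agree by `SCL8`.
  ⋏-¬ : ∀ p → p ⋏ ¬ p ≈ p ⋏ F
  ⋏-¬ p = begin
    p ⋏ ¬ p                  ≈⟨ ⋏-cong (⋎-identityʳ p) (⋎-identityʳ (¬ p)) ⟨
    (p ⋎ F) ⋏ (¬ p ⋎ F)      ≈⟨ ite-⋎-form F p F ⟨
    (p ⋏ F) ⋎ (¬ p ⋏ F)      ≈⟨ ⋎-cong refl (⋏-F p) ⟨
    (p ⋏ F) ⋎ (p ⋏ F)        ≈⟨ ⋏-⋎-⋏F p F ⟩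
    p ⋏ F                    ∎

  ⋏-¬-⋏ : ∀ p q → p ⋏ (¬ p ⋏ q) ≈ p ⋏ F
  ⋏-¬-⋏ p q = begin
    p ⋏ (¬ p ⋏ q)  ≈⟨ ⋏-assoc p (¬ p) q ⟨
    (p ⋏ ¬ p) ⋏ q  ≈⟨ ⋏-congʳ (⋏-¬ p) ⟩
    (p ⋏ F) ⋏ q    ≈⟨ ⋏-assoc p F q ⟩
    p ⋏ (F ⋏ q)    ≈⟨ ⋏-congˡ (⋏-zeroˡ q) ⟩
    p ⋏ F          ∎

  -- Once `q` has succeeded, the disjunct for the other branch shrinks to `q ⋏ F`, which is
  -- absorbed.
  ⋏-ite-true : ∀ p q r → q ⋏ ite p q r ≈ q ⋏ p
  ⋏-ite-true p q r = begin
    q ⋏ ite p q r                        ≈⟨ ⋏-distribˡ-⋎ q (q ⋏ p) (¬ q ⋏ r) ⟩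
    (q ⋏ (q ⋏ p)) ⋎ (q ⋏ (¬ q ⋏ r))      ≈⟨ ⋎-cong (sym (⋏-assoc q q p)) (⋏-¬-⋏ q r) ⟩
    ((q ⋏ q) ⋏ p) ⋎ (q ⋏ F)              ≈⟨ ⋎-cong (⋏-congʳ (⋏-idem q)) refl ⟩
    (q ⋏ p) ⋎ (q ⋏ F)                    ≈⟨ ⋏-⋎-⋏F q p ⟩
    q ⋏ p                                ∎

  ite-¬ : ∀ p q r → ite p (¬ q) r ≈ ite r q p
  ite-¬ p q r = begin
    ite p (¬ q) r                    ≈⟨ ite-⋎-form p (¬ q) r ⟩
    (¬ q ⋎ r) ⋏ (¬ (¬ q) ⋎ p)        ≈⟨ ⋏-congˡ (⋎-cong (¬-involutive q) refl) ⟩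
    (¬ q ⋎ r) ⋏ (q ⋎ p)              ≈⟨ ⋎-⋏-¬⋎-comm q p r ⟨
    (q ⋎ p) ⋏ (¬ q ⋎ r)              ≈⟨ ite-⋎-form r q p ⟨
    ite r q p                        ∎

  ⋏-ite-false : ∀ p q r → ¬ q ⋏ ite p q r ≈ ¬ q ⋏ r
  ⋏-ite-false p q r = trans (⋏-congˡ (sym (ite-¬ r q p))) (⋏-ite-true r (¬ q) p)

  -- Brings `p` to the right end, next to whatever follows. The disjunct `p ⋏ F`, added and
  -- rewritten as `p ⋏ ¬ p`, lets `p` be factored out; reading `p` as `p ⋎ F` then makes `MSCL3`
  -- applicable.
  ⋏-as-¬⋎-⋏ : ∀ p q → p ⋏ q ≈ (¬ p ⋎ q) ⋏ p
  ⋏-as-¬⋎-⋏ p q = begin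
    p ⋏ q                      ≈⟨ ⋏F-⋎-⋏ p q ⟨
    (p ⋏ F) ⋎ (p ⋏ q)          ≈⟨ ⋎-cong (⋏-¬ p) refl ⟨
    (p ⋏ ¬ p) ⋎ (p ⋏ q)        ≈⟨ ⋏-distribˡ-⋎ p (¬ p) q ⟨
    p ⋏ (¬ p ⋎ q)              ≈⟨ ⋏-congʳ (⋎-identityʳ p) ⟨
    (p ⋎ F) ⋏ (¬ p ⋎ q)        ≈⟨ ⋎-⋏-¬⋎-comm p F q ⟩
    (¬ p ⋎ q) ⋏ (p ⋎ F)        ≈⟨ ⋏-congˡ (⋎-identityʳ p) ⟩
    (¬ p ⋎ q) ⋏ p              ∎

  -- With `p` at the right end of the first conjunct, associativity puts it directly before `r`,
  -- where the hypothesis applies.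
  ⋏-congˡ-memorized : ∀ p q → p ⋏ r ≈ p ⋏ s → (p ⋏ q) ⋏ r ≈ (p ⋏ q) ⋏ s
  ⋏-congˡ-memorized {r} {s} p q e = begin
    (p ⋏ q) ⋏ r              ≈⟨ ⋏-congʳ (⋏-as-¬⋎-⋏ p q) ⟩
    ((¬ p ⋎ q) ⋏ p) ⋏ r      ≈⟨ ⋏-assoc (¬ p ⋎ q) p r ⟩
    (¬ p ⋎ q) ⋏ (p ⋏ r)      ≈⟨ ⋏-congˡ e ⟩
    (¬ p ⋎ q) ⋏ (p ⋏ s)      ≈⟨ ⋏-assoc (¬ p ⋎ q) p s ⟨
    ((¬ p ⋎ q) ⋏ p) ⋏ s      ≈⟨ ⋏-congʳ (⋏-as-¬⋎-⋏ p q) ⟨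
    (p ⋏ q) ⋏ s              ∎

  -- The interpreted axioms of MSCL

  ite-cp1 : ∀ p q → ite p T q ≈ p
  ite-cp1 p q = begin
    (T ⋏ p) ⋎ (¬ T ⋏ q)  ≈⟨ ⋎-cong (⋏-identityˡ p) (⋏-congʳ (sym F≈¬T)) ⟩
    p ⋎ (F ⋏ q)          ≈⟨ ⋎-cong refl (⋏-zeroˡ q) ⟩
    p ⋎ F                ≈⟨ ⋎-identityʳ p ⟩
    p                    ∎

  ite-cp2 : ∀ p q → ite p F q ≈ q
  ite-cp2 p q = begin
    ite p F q      ≈⟨ ite-cong refl F≈¬T refl ⟩
    ite p (¬ T) q  ≈⟨ ite-¬ p T q ⟩
    ite q T p      ≈⟨ ite-cp1 q p ⟩
    q              ∎

  ite-⋏F : ∀ p q → ite p q F ≈ q ⋏ p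
  -- `SCL8` turns the else-part `¬ q ⋏ F` into the absorbable `q ⋏ F`.
  ite-⋏F p q = trans (⋎-cong refl (sym (⋏-F q))) (⋏-⋎-⋏F q p)

  ite-cp3 : ∀ p → ite T p F ≈ p
  ite-cp3 p = trans (ite-⋏F T p) (⋏-identityʳ p)

  ite-F-T : ∀ p → ite F p T ≈ ¬ p
  ite-F-T p = begin
    ite F p T          ≈⟨ ite-cong F≈¬T refl (sym ¬F≈T) ⟩
    ite (¬ T) p (¬ F)  ≈⟨ ¬-ite T p F ⟨
    ¬ (ite T p F)      ≈⟨ ¬-cong (ite-cp3 p) ⟩
    ¬ p                ∎

  -- The second conditional moves into both branches of the first, where `q` is already decided and
  -- selects one of its branches.
  ite-⋎-ite : ∀ p p′ q r r′ → ite p q r ⋎ ite p′ q r′ ≈ ite (p ⋎ p′) q (r ⋎ r′)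
  ite-⋎-ite p p′ q r r′ = begin
    ite p q r ⋎ t                              ≈⟨ ite-⋎ p q r t ⟩
    (q ⋏ (p ⋎ t)) ⋎ (¬ q ⋏ (r ⋎ t))
      ≈⟨ ⋎-cong (under q (⋏-ite-true p′ q r′)) (under (¬ q) (⋏-ite-false p′ q r′)) ⟩
    (q ⋏ (p ⋎ p′)) ⋎ (¬ q ⋏ (r ⋎ r′))          ∎
    where
    t = ite p′ q r′

    -- Distributing `a` exposes `a ⋏ c`, although `c` sits behind `b`.
    under : ∀ a {b c d} → a ⋏ c ≈ a ⋏ d → a ⋏ (b ⋎ c) ≈ a ⋏ (b ⋎ d)
    under a {b} {c} {d} e = begin
      a ⋏ (b ⋎ c)          ≈⟨ ⋏-distribˡ-⋎ a b c ⟩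
      (a ⋏ b) ⋎ (a ⋏ c)    ≈⟨ ⋎-cong refl e ⟩
      (a ⋏ b) ⋎ (a ⋏ d)    ≈⟨ ⋏-distribˡ-⋎ a b d ⟨
      a ⋏ (b ⋎ d)          ∎

  -- The compound condition and its negation each become a conditional on `r`, and two conditionals
  -- on the same condition merge branchwise.
  ite-cp4 : ∀ p q r s t → ite p (ite q r s) t ≈ ite (ite p q t) r (ite p s t)
  ite-cp4 p q r s t = begin
    (ite q r s ⋏ p) ⋎ (¬ (ite q r s) ⋏ t)
      ≈⟨ ⋎-cong (ite-⋏ q r s p) (trans (⋏-congʳ (¬-ite q r s)) (ite-⋏ (¬ q) r (¬ s) t)) ⟩
    ite (q ⋏ p) r (s ⋏ p) ⋎ ite (¬ q ⋏ t) r (¬ s ⋏ t)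
      ≈⟨ ite-⋎-ite (q ⋏ p) (¬ q ⋏ t) r (s ⋏ p) (¬ s ⋏ t) ⟩
    ite (ite p q t) r (ite p s t)
      ∎

  -- Only the else-branch changes. There `¬ q` is still remembered after `¬ s`, so the inner
  -- conditional on `q` reduces to `t′`.
  ite-cpmem : ∀ p q r s t t′ →
              ite p q (ite r s (ite t q t′)) ≈ ite p q (ite r s t′)
  ite-cpmem p q r s t t′ = ⋎-cong refl (begin
    ¬ q ⋏ ite r s (ite t q t′)
      ≈⟨ ⋏-distribˡ-⋎ (¬ q) (s ⋏ r) (¬ s ⋏ ite t q t′) ⟩
    (¬ q ⋏ (s ⋏ r)) ⋎ (¬ q ⋏ (¬ s ⋏ ite t q t′))
      ≈⟨ ⋎-cong refl (begin
           ¬ q ⋏ (¬ s ⋏ ite t q t′)  ≈⟨ ⋏-assoc (¬ q) (¬ s) (ite t q t′) ⟨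
           (¬ q ⋏ ¬ s) ⋏ ite t q t′  ≈⟨ ⋏-congˡ-memorized (¬ q) (¬ s) (⋏-ite-false t q t′) ⟩
           (¬ q ⋏ ¬ s) ⋏ t′          ≈⟨ ⋏-assoc (¬ q) (¬ s) t′ ⟩
           ¬ q ⋏ (¬ s ⋏ t′)          ∎) ⟩
    (¬ q ⋏ (s ⋏ r)) ⋎ (¬ q ⋏ (¬ s ⋏ t′))
      ≈⟨ ⋏-distribˡ-⋎ (¬ q) (s ⋏ r) (¬ s ⋏ t′) ⟨
    ¬ q ⋏ ite r s t′
      ∎)

  -- Interpretation of MSCL-terms as SCL-terms

  interpretOp : ∀ {n} → MSCLOp A n → Vec (SCLTerm A) n → SCLTerm A
  interpretOp true     ts               = op true ts
  interpretOp false    ts               = op false ts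
  interpretOp (atom a) ts               = op (atom a) ts
  interpretOp neg      ts               = op neg ts
  interpretOp conj     ts               = op conj ts
  interpretOp disj     ts               = op disj ts
  interpretOp cond     (r ∷ s ∷ t ∷ []) = ite r s t

  interpretOp-cong : ∀ {n} (f : MSCLOp A n) {ss ts} → Pointwise _≈_ ss ts →
                     interpretOp f ss ≈ interpretOp f ts
  interpretOp-cong true     es               = cong true es
  interpretOp-cong false    es               = cong false es
  interpretOp-cong (atom a) es               = cong (atom a) es
  interpretOp-cong neg      es               = cong neg es
  interpretOp-cong conj     es               = cong conj es
  interpretOp-cong disj     es               = cong disj es
  interpretOp-cong cond     (e ∷ f ∷ g ∷ []) = ite-cong e f g

  interpretOp-[] : ∀ {n} (f : MSCLOp A n) ts (σ : ℕ → SCLTerm A) →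
                   interpretOp f ts [ σ ] ≡ interpretOp f (ts [ σ ]*)
  interpretOp-[] true     ts               σ = ≡.refl
  interpretOp-[] false    ts               σ = ≡.refl
  interpretOp-[] (atom a) ts               σ = ≡.refl
  interpretOp-[] neg      ts               σ = ≡.refl
  interpretOp-[] conj     ts               σ = ≡.refl
  interpretOp-[] disj     ts               σ = ≡.refl
  interpretOp-[] cond     (r ∷ s ∷ t ∷ []) σ = ≡.refl

  interpretOp-embedOp : ∀ {n} (f : SCLOp A n) ts → interpretOp (embedOp f) ts ≡ op f ts
  interpretOp-embedOp true     ts = ≡.refl
  interpretOp-embedOp false    ts = ≡.refl
  interpretOp-embedOp (atom a) ts = ≡.refl
  interpretOp-embedOp neg      ts = ≡.refl
  interpretOp-embedOp conj     ts = ≡.refl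
  interpretOp-embedOp disj     ts = ≡.refl

  interpret  : MSCLTerm A → SCLTerm A
  interpret* : ∀ {n} → Vec (MSCLTerm A) n → Vec (SCLTerm A) n

  interpret (var i)   = var i
  interpret (op f ts) = interpretOp f (interpret* ts)

  interpret* []       = []
  interpret* (t ∷ ts) = interpret t ∷ interpret* ts

  interpret-embed   : ∀ t → interpret (embed t) ≡ t
  interpret*-embed* : ∀ {n} (ts : Vec (SCLTerm A) n) → interpret* (embed* ts) ≡ ts

  interpret-embed (var i)   = ≡.refl
  interpret-embed (op f ts) = ≡.trans (interpretOp-embedOp f _)
                                      (≡.cong (op f) (interpret*-embed* ts))

  interpret*-embed* []       = ≡.refl
  interpret*-embed* (t ∷ ts) = ≡.cong₂ _∷_ (interpret-embed t) (interpret*-embed* ts)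

  interpret-[]  : ∀ t (σ : ℕ → MSCLTerm A) →
                 interpret (t [ σ ]) ≡ interpret t [ (λ i → interpret (σ i)) ]
  interpret*-[] : ∀ {n} (ts : Vec (MSCLTerm A) n) (σ : ℕ → MSCLTerm A) →
                  interpret* (ts [ σ ]*) ≡ interpret* ts [ (λ i → interpret (σ i)) ]*

  interpret-[] (var i)   σ = ≡.refl
  interpret-[] (op f ts) σ = ≡.trans (≡.cong (interpretOp f) (interpret*-[] ts σ))
                                     (≡.sym (interpretOp-[] f (interpret* ts) _))

  interpret*-[] []       σ = ≡.refl
  interpret*-[] (t ∷ ts) σ = ≡.cong₂ _∷_ (interpret-[] t σ) (interpret*-[] ts σ)

  -- Soundness of the interpretation

  interpret-axiom : ∀ {s t} → MSCL A s t → interpret s ≈ interpret t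
  interpret-axiom (inj₁ CP1)      = ite-cp1 x y
  interpret-axiom (inj₁ CP2)      = ite-cp2 x y
  interpret-axiom (inj₁ CP3)      = ite-cp3 x
  interpret-axiom (inj₁ CP4)      = ite-cp4 x y z u v
  interpret-axiom (inj₁ CPmem-ax) = ite-cpmem x y z u v w
  interpret-axiom (inj₂ ¬-def)    = sym (ite-F-T x)
  interpret-axiom (inj₂ ⋏-def)    = sym (ite-⋏F y x)
  interpret-axiom (inj₂ ⋎-def)    = axiom SCL2

  -- Ranges over all MSCL-terms, because a derivation between embedded SCL-terms may pass through
  -- conditionals.
  interpret-sound  : ∀ {s t} → MSCL A ⊢ s ≈ t → interpret s ≈ interpret t
  interpret*-sound : ∀ {n} {ss ts : Vec (MSCLTerm A) n} →
                     Pointwise (MSCL A ⊢_≈_) ss ts →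
                     Pointwise _≈_ (interpret* ss) (interpret* ts)

  interpret-sound (axiom e)   = interpret-axiom e
  interpret-sound refl        = refl
  interpret-sound (sym d)     = sym (interpret-sound d)
  interpret-sound (trans d e) = trans (interpret-sound d) (interpret-sound e)
  interpret-sound (cong f ds) = interpretOp-cong f (interpret*-sound ds)
  -- The values of `σ` may contain conditionals, so they are interpreted as well.
  interpret-sound (subst {s} {t} σ d) =
    ≡.subst₂ _≈_ (≡.sym (interpret-[] s σ)) (≡.sym (interpret-[] t σ))
      (subst (λ i → interpret (σ i)) (interpret-sound d))

  interpret*-sound []       = []
  interpret*-sound (d ∷ ds) = interpret-sound d ∷ interpret*-sound ds

theorem8 : (A : Set) → A ↣ ℕ → (t t′ : SCLTerm A) →
    MSCL A ⊢ embed t ≈ embed t′ → EqMSCL A ⊢ t ≈ t′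
theorem8 A _ t t′ d =
  ≡.subst₂ _≈_ (interpret-embed t) (interpret-embed t′) (interpret-sound d)
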